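{- The one-sided amalgamation property (hence also the amalgamation property) fails for the class of idempotent residuated chains. The one-sided amalgamation property also fails for the class of finitely subdirectly irreducible conic idempotent residuated lattices.
   Context: A residuated lattice is an algebra $(A,\wedge,\vee,\cdot,\backslash,/,1)$ such that $(A,\wedge,\vee)$ is a lattice, $(A,\cdot,1)$ is a monoid, and $y\le x\backslash z \iff x\cdot y\le z\iff x\le z/y$ for all $x,y,z$. It is idempotent if it satisfies $x\cdot x=x$, conic if every $a\in A$ satisfies $a\le 1$ or $1\le a$, and a residuated chain if its lattice order is total. An algebra is finitely subdirectly irreducible if its identity congruence is not the intersection of two congruences both different from the identity congruence (trivial algebras are counted as finitely subdirectly irreducible). A class $\mathcal K$ of similar algebras has the one-sided amalgamation property if for all $\mathbf A,\mathbf B,\mathbf C\in\mathcal K$ and embeddings $f_B\colon\mathbf A\to\mathbf B$, $f_C\colon\mathbf A\to\mathbf C$ there are $\mathbf D\in\mathcal K$, a homomorphism $g_B\colon\mathbf B\to\mathbf D$ (not necessarily injective) and an embedding $g_C\colon\mathbf C\to\mathbf D$ with $g_B\circ f_B=g_C\circ f_C$. The amalgamation property is defined in the same way but with both $g_B$ and $g_C$ required to be embeddings. -}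

module Defs where

open import Algebra.Bundles using (RawMonoid)
open import Algebra.Core using (Op₂)
open import Algebra.Definitions using (Idempotent; Congruent₂)
open import Algebra.Lattice.Bundles using (RawLattice)
open import Algebra.Lattice.Morphism.Structures using (IsLatticeHomomorphism)
open import Algebra.Lattice.Structures using (IsLattice)
open import Algebra.Morphism.Definitions using (Homomorphic₂)
open import Algebra.Morphism.Structures using (IsMonoidHomomorphism)
open import Algebra.Structures using (IsMonoid)
open import Data.Product using (Σ-syntax; _×_)
open import Data.Sum using (_⊎_)
open import Function.Bundles using (_⇔_)
open import Function.Definitions using (Injective)
open import Level using (Level; suc; _⊔_)
open import Relation.Binary.Construct.Intersection using (_∩_)
import Relation.Binary.Construct.NaturalOrder.Left as LeftNaturalOrder
open import Relation.Binary.Core using (Rel; _⇒_) renaming (_⇔_ to _≐_)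
open import Relation.Binary.Definitions using (Total)
open import Relation.Binary.Structures using (IsEquivalence)
open import Relation.Nullary using (¬_)

-- The residuals x \ z and z / y are written x \\ z and z // y.  That they
-- respect _≈_ follows from the residuation laws, so it is not a field.
record ResiduatedLattice (c ℓ : Level) : Set (suc (c ⊔ ℓ)) where
  infix  4 _≈_
  infixr 6 _∨_
  infixr 7 _∧_
  infixl 8 _∙_
  infixr 8 _\\_
  infixl 8 _//_
  field
    Carrier : Set c
    _≈_     : Rel Carrier ℓ
    _∧_     : Op₂ Carrier
    _∨_     : Op₂ Carrier
    _∙_     : Op₂ Carrier
    _\\_    : Op₂ Carrier
    _//_    : Op₂ Carrier
    ε       : Carrier

  -- x ≤ y unfolds to x ≈ (x ∧ y).
  open LeftNaturalOrder _≈_ _∧_ public using (_≤_)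

  field
    isLattice   : IsLattice _≈_ _∨_ _∧_
    isMonoid    : IsMonoid _≈_ _∙_ ε
    \\-residual : ∀ x y z → (y ≤ (x \\ z)) ⇔ ((x ∙ y) ≤ z)
    //-residual : ∀ x y z → ((x ∙ y) ≤ z) ⇔ (x ≤ (z // y))

  rawLattice : RawLattice c ℓ
  rawLattice = record { Carrier = Carrier ; _≈_ = _≈_ ; _∧_ = _∧_ ; _∨_ = _∨_ }

  rawMonoid : RawMonoid c ℓ
  rawMonoid = record { Carrier = Carrier ; _≈_ = _≈_ ; _∙_ = _∙_ ; ε = ε }

module _ {c ℓ : Level} where

  IsIdempotent : ResiduatedLattice c ℓ → Set (c ⊔ ℓ)
  IsIdempotent A = Idempotent _≈_ _∙_
    where open ResiduatedLattice A

  IsConic : ResiduatedLattice c ℓ → Set (c ⊔ ℓ)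
  IsConic A = ∀ a → (a ≤ ε) ⊎ (ε ≤ a)
    where open ResiduatedLattice A

  IsChain : ResiduatedLattice c ℓ → Set (c ⊔ ℓ)
  IsChain A = Total _≤_
    where open ResiduatedLattice A

  -- A congruence must contain _≈_, the equality of the carrier setoid.  Its
  -- truth values lie in Set (c ⊔ ℓ), the level at which the congruence
  -- inductively generated by a set of pairs lives.
  record Congruence (A : ResiduatedLattice c ℓ) : Set (suc (c ⊔ ℓ)) where
    open ResiduatedLattice A
    field
      _~_           : Rel Carrier (c ⊔ ℓ)
      isEquivalence : IsEquivalence _~_
      ≈⇒~           : _≈_ ⇒ _~_
      ∧-compatible  : Congruent₂ _~_ _∧_
      ∨-compatible  : Congruent₂ _~_ _∨_
      ∙-compatible  : Congruent₂ _~_ _∙_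
      \\-compatible : Congruent₂ _~_ _\\_
      //-compatible : Congruent₂ _~_ _//_

  -- The identity congruence is _≈_; relations are compared extensionally.
  IsFSI : ResiduatedLattice c ℓ → Set (suc (c ⊔ ℓ))
  IsFSI A =
    ¬ (Σ[ θ ∈ Congruence A ] Σ[ ψ ∈ Congruence A ]
        ((_≈_ ≐ (rel θ ∩ rel ψ)) × ¬ (rel θ ≐ _≈_) × ¬ (rel ψ ≐ _≈_)))
    where
    open ResiduatedLattice A
    rel : Congruence A → Rel Carrier (c ⊔ ℓ)
    rel = Congruence._~_

  record Homomorphism (A B : ResiduatedLattice c ℓ) : Set (c ⊔ ℓ) where
    private
      module A = ResiduatedLattice A
      module B = ResiduatedLattice B
    field
      ⟦_⟧                   : A.Carrier → B.Carrier
      isLatticeHomomorphism : IsLatticeHomomorphism A.rawLattice B.rawLattice ⟦_⟧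
      isMonoidHomomorphism  : IsMonoidHomomorphism A.rawMonoid B.rawMonoid ⟦_⟧
      \\-homo               : Homomorphic₂ A.Carrier B.Carrier B._≈_ ⟦_⟧ A._\\_ B._\\_
      //-homo               : Homomorphic₂ A.Carrier B.Carrier B._≈_ ⟦_⟧ A._//_ B._//_

  record Embedding (A B : ResiduatedLattice c ℓ) : Set (c ⊔ ℓ) where
    private
      module A = ResiduatedLattice A
      module B = ResiduatedLattice B
    field
      homomorphism : Homomorphism A B
    open Homomorphism homomorphism public
    field
      injective : Injective A._≈_ B._≈_ ⟦_⟧

  Commutes : {A B C D : ResiduatedLattice c ℓ} →
             Homomorphism A B → Homomorphism A C →
             Homomorphism B D → Homomorphism C D → Set (c ⊔ ℓ)
  Commutes {A} {B} {C} {D} fB fC gB gC =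
    ∀ (x : ResiduatedLattice.Carrier A) → gB.⟦ fB.⟦ x ⟧ ⟧ ≈ gC.⟦ fC.⟦ x ⟧ ⟧
    where
    open ResiduatedLattice D using (_≈_)
    module fB = Homomorphism fB
    module fC = Homomorphism fC
    module gB = Homomorphism gB
    module gC = Homomorphism gC

  OneSidedAmalgamation : {k : Level} → (ResiduatedLattice c ℓ → Set k) →
                         Set (suc (c ⊔ ℓ) ⊔ k)
  OneSidedAmalgamation K =
    ∀ (A B C : ResiduatedLattice c ℓ) → K A → K B → K C →
    (fB : Embedding A B) (fC : Embedding A C) →
    Σ[ D ∈ ResiduatedLattice c ℓ ] K D ×
      (Σ[ gB ∈ Homomorphism B D ] Σ[ gC ∈ Embedding C D ]
        Commutes (hom fB) (hom fC) gB (hom gC))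
    where
    hom : {X Y : ResiduatedLattice c ℓ} → Embedding X Y → Homomorphism X Y
    hom = Embedding.homomorphism

  Amalgamation : {k : Level} → (ResiduatedLattice c ℓ → Set k) →
                 Set (suc (c ⊔ ℓ) ⊔ k)
  Amalgamation K =
    ∀ (A B C : ResiduatedLattice c ℓ) → K A → K B → K C →
    (fB : Embedding A B) (fC : Embedding A C) →
    Σ[ D ∈ ResiduatedLattice c ℓ ] K D ×
      (Σ[ gB ∈ Embedding B D ] Σ[ gC ∈ Embedding C D ]
        Commutes (hom fB) (hom fC) (hom gB) (hom gC))
    where
    hom : {X Y : ResiduatedLattice c ℓ} → Embedding X Y → Homomorphism X Y
    hom = Embedding.homomorphism

IdempotentChain : (c ℓ : Level) → ResiduatedLattice c ℓ → Set (c ⊔ ℓ)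
IdempotentChain c ℓ A = IsIdempotent A × IsChain A

FSIConicIdempotent : (c ℓ : Level) → ResiduatedLattice c ℓ → Set (suc (c ⊔ ℓ))
FSIConicIdempotent c ℓ A = IsFSI A × IsConic A × IsIdempotent A

-- The amalgamation base is the three-element chain A = {⊥ < 1 < ⊤}.  The chain
-- B = {⊥ < b < 1 < d < ⊤} adds a left-zero band {b, d}, that is, b d = b and
-- d b = d; C is the opposite of B, where the corresponding pair {b′, d′} is a
-- right-zero band.  The two pairs are incompatible in a conic idempotent
-- residuated lattice: 1 / b = 1 and b′ \ 1 = 1 force d′ b = d′ and b′ d = d
-- unless d or d′ is 1, and then, whatever the sign of b d′, associativity and
-- the commutativity of negative elements yield d′ = 1.  But d′ ≠ 1 by
-- injectivity on C, and d = 1 would collapse ⊥ = d \ 1 with 1, contradicting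
-- injectivity on A.  The three chains are simple, hence finitely subdirectly
-- irreducible.

module Submission where

import Algebra.Construct.NaturalChoice.Max as Max
import Algebra.Construct.NaturalChoice.Min as Min
open import Algebra.Core using (Op₂)
open import Algebra.Lattice.Bundles using (Lattice)
import Algebra.Lattice.Construct.NaturalChoice.MinMaxOp as MinMaxOp
open import Algebra.Lattice.Morphism.Structures using (IsLatticeHomomorphism)
import Algebra.Lattice.Properties.Lattice as LatticeProperties
open import Algebra.Lattice.Structures using (IsLattice)
open import Algebra.Morphism.Structures using (IsMonoidHomomorphism)
open import Algebra.Structures using (IsMonoid)
open import Data.Fin using (Fin; _≟_)
open import Data.Fin.Patterns
open import Data.Fin.Properties using (all?; ≤-totalOrder)
open import Data.Nat using (ℕ)
open import Data.Product using (_×_; _,_; proj₁; proj₂)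
open import Data.Sum as Sum using (_⊎_; inj₁; inj₂; [_,_])
open import Data.Vec using (Vec; []; _∷_; lookup; transpose)
open import Defs
open import Function using (id; _∘_)
open import Function.Bundles using (mk⇔; module Equivalence)
open import Level using (Level; Lift; lift; lower; 0ℓ)
open import Relation.Binary.Bundles using (Poset)
import Relation.Binary.Construct.NaturalOrder.Left as LeftNaturalOrder
open import Relation.Binary.Core using (Rel) renaming (_⇔_ to _≐_)
open import Relation.Binary.Definitions using (Decidable)
open import Relation.Binary.PropositionalEquality as ≡ using (_≡_; refl; cong; cong₂)
import Relation.Binary.Reasoning.Setoid as SetoidReasoning
open import Relation.Binary.Structures using (IsEquivalence)
open import Relation.Nullary using (¬_; contradiction)
open import Relation.Nullary.Decidable
  using (Dec; map′; _×-dec_; _⊎-dec_; _→-dec_; ¬?; from-yes)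

-- Monotonicity and congruence consequences of residuation.

module ResiduatedLatticeProperties {c ℓ} (D : ResiduatedLattice c ℓ) where
  open ResiduatedLattice D public
  open IsMonoid isMonoid public
    using (identityˡ; identityʳ; assoc; ∙-congˡ; ∙-congʳ; sym; trans; setoid)

  private
    lattice : Lattice c ℓ
    lattice = record { isLattice = isLattice }

    poset : Poset c ℓ ℓ
    poset = LeftNaturalOrder.poset _≈_ _∧_
              (LatticeProperties.∧-isSemilattice lattice)

  open Poset poset public
    using (antisym; ≤-respˡ-≈; ≤-respʳ-≈)
    renaming (refl to ≤-refl; trans to ≤-trans; reflexive to ≤-reflexive)

  ∙-monoʳ : ∀ z {x y} → x ≤ y → (z ∙ x) ≤ (z ∙ y)
  ∙-monoʳ z {x} {y} x≤y =
    Equivalence.to (\\-residual z x (z ∙ y))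
      (≤-trans x≤y (Equivalence.from (\\-residual z y (z ∙ y)) ≤-refl))

  ∙-monoˡ : ∀ z {x y} → x ≤ y → (x ∙ z) ≤ (y ∙ z)
  ∙-monoˡ z {x} {y} x≤y =
    Equivalence.from (//-residual x z (y ∙ z))
      (≤-trans x≤y (Equivalence.to (//-residual y z (y ∙ z)) ≤-refl))

  \\-congˡ : ∀ z {x y} → x ≈ y → (z \\ x) ≈ (z \\ y)
  \\-congˡ z x≈y = antisym (below x≈y) (below (sym x≈y))
    where
    below : ∀ {x y} → x ≈ y → (z \\ x) ≤ (z \\ y)
    below {x} {y} x≈y = Equivalence.from (\\-residual z (z \\ x) y)
      (≤-respʳ-≈ x≈y (Equivalence.to (\\-residual z (z \\ x) x) ≤-refl))

  //-congʳ : ∀ z {x y} → x ≈ y → (x // z) ≈ (y // z)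
  //-congʳ z x≈y = antisym (below x≈y) (below (sym x≈y))
    where
    below : ∀ {x y} → x ≈ y → (x // z) ≤ (y // z)
    below {x} {y} x≈y = Equivalence.to (//-residual (x // z) z y)
      (≤-respʳ-≈ x≈y (Equivalence.from (//-residual (x // z) z x) ≤-refl))

-- Products of positive and negative elements under idempotence.

module _ {c ℓ} (D : ResiduatedLattice c ℓ) (idem : IsIdempotent D) where
  open ResiduatedLatticeProperties D
  open SetoidReasoning setoid

  -- Idempotence gives `x ∙ y ≈ x ∙ (x ∙ y)`, which lies below `x ∙ ε`; the other inequality is
  -- monotonicity.
  ≤ε⇒∙-absorbs : ∀ {x y} → ε ≤ y → (x ∙ y) ≤ ε → (x ∙ y) ≈ x
  ≤ε⇒∙-absorbs {x} {y} ε≤y xy≤ε = antisym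
    (≤-respˡ-≈ (trans (sym (assoc x x y)) (∙-congʳ (idem x)))
      (≤-respʳ-≈ (identityʳ x) (∙-monoʳ x xy≤ε)))
    (≤-respˡ-≈ (identityʳ x) (∙-monoʳ x ε≤y))

  -- Multiplying `ε ≤ x ∙ y` on the right by `y` and contracting `y ∙ y` gives `y ≤ x ∙ y`.
  ε≤⇒∙-absorbs : ∀ {x y} → x ≤ ε → ε ≤ (x ∙ y) → (x ∙ y) ≈ y
  ε≤⇒∙-absorbs {x} {y} x≤ε ε≤xy = antisym
    (≤-respʳ-≈ (identityˡ y) (∙-monoˡ y x≤ε))
    (≤-respˡ-≈ (identityˡ y)
      (≤-respʳ-≈ (trans (assoc x y y) (∙-congˡ (idem y))) (∙-monoˡ y ε≤xy)))

  ε≤⇒∙-absorbsʳ : ∀ {x y} → x ≤ ε → ε ≤ (y ∙ x) → (y ∙ x) ≈ y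
  ε≤⇒∙-absorbsʳ {x} {y} x≤ε ε≤yx = antisym
    (≤-respʳ-≈ (identityʳ y) (∙-monoʳ y x≤ε))
    (≤-respˡ-≈ (identityʳ y)
      (≤-respʳ-≈ (trans (sym (assoc y y x)) (∙-congʳ (idem y))) (∙-monoʳ y ε≤yx)))

  -- The product `x ∙ y` equals its own square; there the first factor is at most `y` and the second
  -- at most `x`.
  negative-∙-comm : ∀ {x y} → x ≤ ε → y ≤ ε → (x ∙ y) ≈ (y ∙ x)
  negative-∙-comm x≤ε y≤ε = antisym (below x≤ε y≤ε) (below y≤ε x≤ε)
    where
    below : ∀ {x y} → x ≤ ε → y ≤ ε → (x ∙ y) ≤ (y ∙ x)
    below {x} {y} x≤ε y≤ε =
      ≤-respˡ-≈ (idem (x ∙ y))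
        (≤-trans (∙-monoˡ (x ∙ y) (≤-respʳ-≈ (identityˡ y) (∙-monoˡ y x≤ε)))
          (∙-monoʳ y (≤-respʳ-≈ (identityʳ x) (∙-monoʳ x y≤ε))))

  -- A left-zero pair `x`, `y` and a right-zero pair `x′`, `y` share the positive element `y`. Since
  -- `x` and `x′` commute, `x` can be moved next to `y` and absorbed there, so `x ∙ x′ ≈ x′`; this
  -- in turn forces `x ≈ y`, and `y` is negative as well.
  bands-collapse : ∀ {x x′ y} → x ≤ ε → x′ ≤ ε → ε ≤ y →
                   (x ∙ y) ≈ x → (y ∙ x) ≈ y → (x′ ∙ y) ≈ y → (y ∙ x′) ≈ x′ →
                   y ≈ ε
  bands-collapse {x} {x′} {y} x≤ε x′≤ε ε≤y xy≈x yx≈y x′y≈y yx′≈x′ =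
    antisym (≤-respˡ-≈ x≈y x≤ε) ε≤y
    where
    xx′≈x′ : (x ∙ x′) ≈ x′
    xx′≈x′ = begin
      x ∙ x′        ≈⟨ negative-∙-comm x≤ε x′≤ε ⟩
      x′ ∙ x        ≈⟨ ∙-congʳ yx′≈x′ ⟨
      (y ∙ x′) ∙ x  ≈⟨ assoc y x′ x ⟩
      y ∙ (x′ ∙ x)  ≈⟨ ∙-congˡ (negative-∙-comm x′≤ε x≤ε) ⟩
      y ∙ (x ∙ x′)  ≈⟨ assoc y x x′ ⟨
      (y ∙ x) ∙ x′  ≈⟨ ∙-congʳ yx≈y ⟩
      y ∙ x′        ≈⟨ yx′≈x′ ⟩
      x′            ∎

    x≈y : x ≈ y
    x≈y = begin
      x             ≈⟨ xy≈x ⟨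
      x ∙ y         ≈⟨ ∙-congˡ x′y≈y ⟨
      x ∙ (x′ ∙ y)  ≈⟨ assoc x x′ y ⟨
      (x ∙ x′) ∙ y  ≈⟨ ∙-congʳ xx′≈x′ ⟩
      x′ ∙ y        ≈⟨ x′y≈y ⟩
      y             ∎

  module _ (conic : IsConic D) where

    -- The four elements stand for the images of b, d, b′ and d′. The two residual hypotheses
    -- dispose of the cases in which `x′ ∙ y` or `y′ ∙ x` is negative; in the remaining ones both
    -- products absorb their negative factor, and the sign of `x ∙ y′` decides how to continue.
    opposite-twins-collapse :
      ∀ {x y x′ y′} → x ≤ ε → x′ ≤ ε → ε ≤ y → ε ≤ y′ →
      (x ∙ y) ≈ x → (x′ ∙ y′) ≈ y′ → (y′ ∙ x′) ≈ x′ →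
      (ε // x) ≈ ε → (x′ \\ ε) ≈ ε →
      y ≈ ε ⊎ y′ ≈ ε
    opposite-twins-collapse {x} {y} {x′} {y′} x≤ε x′≤ε ε≤y ε≤y′
      xy≈x x′y′≈y′ y′x′≈x′ ε/x≈ε x′\ε≈ε
      with conic (x′ ∙ y) | conic (y′ ∙ x) | conic (x ∙ y′)
    ... | inj₁ x′y≤ε | _ | _ = inj₁ (antisym
      (≤-respʳ-≈ x′\ε≈ε (Equivalence.from (\\-residual x′ y ε) x′y≤ε)) ε≤y)
    ... | inj₂ _ | inj₁ y′x≤ε | _ = inj₂ (antisym
      (≤-respʳ-≈ ε/x≈ε (Equivalence.to (//-residual y′ x ε) y′x≤ε)) ε≤y′)
    -- Now `x`, `y′` is itself a left-zero pair, sharing `y′` with the right-zero pair `x′`, `y′`.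
    ... | inj₂ _ | inj₂ ε≤y′x | inj₁ xy′≤ε = inj₂
      (bands-collapse x≤ε x′≤ε ε≤y′
        (≤ε⇒∙-absorbs ε≤y′ xy′≤ε) (ε≤⇒∙-absorbsʳ x≤ε ε≤y′x) x′y′≈y′ y′x′≈x′)
    -- Now `x ∙ y′ ≈ y′`. Both `y` and `y′` turn out equal to `y′ ∙ y`, so `x ∙ y ≈ x` makes `x`
    -- equal to `y′`.
    ... | inj₂ ε≤x′y | inj₂ ε≤y′x | inj₂ ε≤xy′ = inj₂ (antisym
      (≤-respˡ-≈ x≈y′ x≤ε) ε≤y′)
      where
      y≈y′ : y ≈ y′
      y≈y′ = begin
        y              ≈⟨ ε≤⇒∙-absorbs x′≤ε ε≤x′y ⟨
        x′ ∙ y         ≈⟨ ∙-congʳ y′x′≈x′ ⟨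
        (y′ ∙ x′) ∙ y  ≈⟨ assoc y′ x′ y ⟩
        y′ ∙ (x′ ∙ y)  ≈⟨ ∙-congˡ (ε≤⇒∙-absorbs x′≤ε ε≤x′y) ⟩
        y′ ∙ y         ≈⟨ ∙-congʳ (ε≤⇒∙-absorbsʳ x≤ε ε≤y′x) ⟨
        (y′ ∙ x) ∙ y   ≈⟨ assoc y′ x y ⟩
        y′ ∙ (x ∙ y)   ≈⟨ ∙-congˡ xy≈x ⟩
        y′ ∙ x         ≈⟨ ε≤⇒∙-absorbsʳ x≤ε ε≤y′x ⟩
        y′             ∎

      x≈y′ : x ≈ y′
      x≈y′ = begin
        x       ≈⟨ xy≈x ⟨
        x ∙ y   ≈⟨ ∙-congˡ y≈y′ ⟩
        x ∙ y′  ≈⟨ ε≤⇒∙-absorbs x≤ε ε≤xy′ ⟩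
        y′      ∎

-- Finite chains given by operation tables.

-- Row x, column y of the tables holds x ∙ y, x \\ y and x // y respectively.
record Tables (n : ℕ) : Set where
  field
    mul ldiv rdiv : Vec (Vec (Fin n) n) n
    unit          : Fin n

-- Reversing the product exchanges the two residuals together with the order of their arguments,
-- hence the crossed transposes.
opposite : ∀ {n} → Tables n → Tables n
opposite T = record
  { mul = transpose mul ; ldiv = transpose rdiv ; rdiv = transpose ldiv ; unit = unit }
  where open Tables T

module TableChain {n} (T : Tables n) where
  open Tables T public using (unit)
  open Min (≤-totalOrder n) public using (_⊓_; minOperator)
  open Max (≤-totalOrder n) public using (_⊔_; maxOperator)

  infixl 8 _·_
  _·_ _╲_ _╱_ : Op₂ (Fin n)
  x · y = lookup (lookup (Tables.mul T) x) y
  x ╲ y = lookup (lookup (Tables.ldiv T) x) y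
  x ╱ y = lookup (lookup (Tables.rdiv T) x) y

  -- The same shape as the natural order of a residuated lattice, so that decided facts carry over
  -- by `lift` alone.
  _≤_ : Rel (Fin n) 0ℓ
  x ≤ y = x ≡ x ⊓ y

  _≤?_ : Decidable _≤_
  x ≤? y = x ≟ x ⊓ y

  -- A congruence relating x ≠ y relates collapse x y = bot to
  -- collapse y y = unit, so the chains below are simple.
  distance collapse : Op₂ (Fin n)
  distance x y = ((x ╲ y) ⊓ (y ╲ x)) ⊓ unit
  collapse x y = ((distance x y ╲ unit) ╲ unit) ⊓ (unit ╱ (unit ╱ distance x y))

  record Laws (bot : Fin n) : Set where
    constructor laws
    field
      assoc      : ∀ x y z → (x · y) · z ≡ x · (y · z)
      identity   : ∀ x → unit · x ≡ x × x · unit ≡ x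
      idem       : ∀ x → x · x ≡ x
      total      : ∀ x y → x ≤ y ⊎ y ≤ x
      ╲-residual : ∀ x y z → (y ≤ (x ╲ z) → (x · y) ≤ z) × ((x · y) ≤ z → y ≤ (x ╲ z))
      ╱-residual : ∀ x y z → ((x · y) ≤ z → x ≤ (z ╱ y)) × (x ≤ (z ╱ y) → (x · y) ≤ z)
      collapse-≡ : ∀ x → collapse x x ≡ unit
      collapse-≢ : ∀ x y → x ≡ y ⊎ collapse x y ≡ bot
      unit≢bot   : ¬ unit ≡ bot

  laws? : ∀ bot → Dec (Laws bot)
  laws? bot = map′
    (λ (a , i , d , t , l , r , c , c′ , u) → laws a i d t l r c c′ u)
    (λ (laws a i d t l r c c′ u) → a , i , d , t , l , r , c , c′ , u)
    (     (all? λ x → all? λ y → all? λ z → (x · y) · z ≟ x · (y · z))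
    ×-dec (all? λ x → unit · x ≟ x ×-dec x · unit ≟ x)
    ×-dec (all? λ x → x · x ≟ x)
    ×-dec (all? λ x → all? λ y → x ≤? y ⊎-dec y ≤? x)
    ×-dec (all? λ x → all? λ y → all? λ z →
            (y ≤? (x ╲ z) →-dec (x · y) ≤? z) ×-dec ((x · y) ≤? z →-dec y ≤? (x ╲ z)))
    ×-dec (all? λ x → all? λ y → all? λ z →
            ((x · y) ≤? z →-dec x ≤? (z ╱ y)) ×-dec (x ≤? (z ╱ y) →-dec (x · y) ≤? z))
    ×-dec (all? λ x → collapse x x ≟ unit)
    ×-dec (all? λ x → all? λ y → x ≟ y ⊎-dec collapse x y ≟ bot)
    ×-dec ¬? (unit ≟ bot))

  module Lifted (c ℓ : Level) {bot : Fin n} (L : Laws bot) where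
    private
      module L = Laws L
      module MM = MinMaxOp minOperator maxOperator
      module ⊔⊓ = IsLattice MM.⊔-⊓-isLattice

      lift₂ : Op₂ (Fin n) → Op₂ (Lift c (Fin n))
      lift₂ _∙_ x y = lift (lower x ∙ lower y)

      cong-lift₂ : (f : Op₂ (Fin n)) → ∀ {x y u v} →
                   Lift ℓ (x ≡ y) → Lift ℓ (u ≡ v) → Lift ℓ (f x u ≡ f y v)
      cong-lift₂ f (lift p) (lift q) = lift (cong₂ f p q)

    chain : ResiduatedLattice c ℓ
    chain = record
      { Carrier     = Lift c (Fin n)
      ; _≈_         = _≈_
      ; _∧_         = lift₂ _⊓_
      ; _∨_         = lift₂ _⊔_
      ; _∙_         = lift₂ _·_
      ; _\\_        = lift₂ _╲_
      ; _//_        = lift₂ _╱_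
      ; ε           = lift unit
      ; isLattice   = record
        { isEquivalence = isEquivalence
        ; ∨-comm        = λ (lift x) (lift y) → lift (⊔⊓.∨-comm x y)
        ; ∨-assoc       = λ (lift x) (lift y) (lift z) → lift (⊔⊓.∨-assoc x y z)
        ; ∨-cong        = cong-lift₂ _⊔_
        ; ∧-comm        = λ (lift x) (lift y) → lift (⊔⊓.∧-comm x y)
        ; ∧-assoc       = λ (lift x) (lift y) (lift z) → lift (⊔⊓.∧-assoc x y z)
        ; ∧-cong        = cong-lift₂ _⊓_
        ; absorptive    = (λ (lift x) (lift y) → lift (⊔⊓.∨-absorbs-∧ x y))
                        , (λ (lift x) (lift y) → lift (⊔⊓.∧-absorbs-∨ x y))
        }
      ; isMonoid    = record
        { isSemigroup = record
          { isMagma = record { isEquivalence = isEquivalence ; ∙-cong = cong-lift₂ _·_ }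
          ; assoc   = λ _ _ _ → lift (L.assoc _ _ _)
          }
        ; identity    = (λ _ → lift (proj₁ (L.identity _)))
                      , (λ _ → lift (proj₂ (L.identity _)))
        }
      ; \\-residual = λ _ _ _ → let to , from = L.╲-residual _ _ _ in
          mk⇔ (λ (lift p) → lift (to p)) (λ (lift p) → lift (from p))
      ; //-residual = λ _ _ _ → let to , from = L.╱-residual _ _ _ in
          mk⇔ (λ (lift p) → lift (to p)) (λ (lift p) → lift (from p))
      }
      where
      _≈_ : Rel (Lift c (Fin n)) ℓ
      x ≈ y = Lift ℓ (lower x ≡ lower y)

      isEquivalence : IsEquivalence _≈_
      isEquivalence = record
        { refl  = lift refl
        ; sym   = λ (lift p) → lift (≡.sym p)
        ; trans = λ (lift p) (lift q) → lift (≡.trans p q)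
        }

    idempotentChain : IdempotentChain c ℓ chain
    idempotentChain =
        (λ _ → lift (L.idem _))
      , (λ x y → Sum.map lift lift (L.total (lower x) (lower y)))

    congruence-simple : (θ : Congruence chain) → let open Congruence θ in
                        ∀ {x y} → x ~ y → lower x ≡ lower y ⊎ lift unit ~ lift bot
    congruence-simple θ {x} {y} x~y =
      Sum.map id (λ p → ~.trans (≈⇒~ (lift (≡.sym (L.collapse-≡ (lower y)))))
                       (~.trans (~.sym collapse-~) (≈⇒~ (lift p))))
        (L.collapse-≢ (lower x) (lower y))
      where
      open Congruence θ
      module ~ = IsEquivalence isEquivalence
      distance-~ : lift (distance (lower x) (lower y)) ~ lift (distance (lower y) (lower y))
      distance-~ = ∧-compatible
        (∧-compatible (\\-compatible x~y ~.refl) (\\-compatible ~.refl x~y)) ~.refl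
      -- The meet serves both orientations: in the chain of `B₀` the left-residual half takes b to ⊥
      -- while the other half takes it to 1, and in the opposite chain the roles are exchanged.
      collapse-~ : lift (collapse (lower x) (lower y)) ~ lift (collapse (lower y) (lower y))
      collapse-~ = ∧-compatible
        (\\-compatible (\\-compatible distance-~ ~.refl) ~.refl)
        (//-compatible ~.refl (//-compatible ~.refl distance-~))

    fsiConicIdempotent : FSIConicIdempotent c ℓ chain
    fsiConicIdempotent = fsi , (λ a → proj₂ idempotentChain a _) , proj₁ idempotentChain
      where
      -- Being different from the identity is a negated statement, so constructively it yields only
      -- a double negation; this suffices for deriving a contradiction.
      nontrivial : (θ : Congruence chain) → let open Congruence θ in
                   ¬ (_~_ ≐ ResiduatedLattice._≈_ chain) → ¬ ¬ (lift unit ~ lift bot)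
      nontrivial θ θ≢≈ ¬unit~bot = θ≢≈
        ( (λ x~y → [ lift , (λ q → contradiction q ¬unit~bot) ] (congruence-simple θ x~y))
        , Congruence.≈⇒~ θ )

      fsi : IsFSI chain
      fsi (θ , ψ , (_ , θ∩ψ⇒≈) , θ≢≈ , ψ≢≈) =
        -- Both congruences relate `unit` to `bot`, hence so does their intersection, which is the
        -- identity.
        nontrivial θ θ≢≈ λ p → nontrivial ψ ψ≢≈ λ q →
          L.unit≢bot (lower (θ∩ψ⇒≈ (p , q)))

-- Embeddings between table chains.

module TableEmbedding {m n} (S : Tables m) (T : Tables n) where
  private
    module S = TableChain S
    module T = TableChain T

  record IsEmbedding (f : Fin m → Fin n) : Set where
    constructor embeds
    field
      ⊓-homo    : ∀ x y → f (x S.⊓ y) ≡ f x T.⊓ f y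
      ⊔-homo    : ∀ x y → f (x S.⊔ y) ≡ f x T.⊔ f y
      ·-homo    : ∀ x y → f (x S.· y) ≡ f x T.· f y
      ╲-homo    : ∀ x y → f (x S.╲ y) ≡ f x T.╲ f y
      ╱-homo    : ∀ x y → f (x S.╱ y) ≡ f x T.╱ f y
      unit-homo : f S.unit ≡ T.unit
      injective : ∀ x y → f x ≡ f y → x ≡ y

  isEmbedding? : ∀ f → Dec (IsEmbedding f)
  isEmbedding? f = map′
    (λ (a , b , c , d , e , u , i) → embeds a b c d e u i)
    (λ (embeds a b c d e u i) → a , b , c , d , e , u , i)
    (     preserves? S._⊓_ T._⊓_
    ×-dec preserves? S._⊔_ T._⊔_
    ×-dec preserves? S._·_ T._·_
    ×-dec preserves? S._╲_ T._╲_
    ×-dec preserves? S._╱_ T._╱_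
    ×-dec f S.unit ≟ T.unit
    ×-dec (all? λ x → all? λ y → f x ≟ f y →-dec x ≟ y))
    where
    preserves? : ∀ (_∙_ : Op₂ (Fin m)) (_∘_ : Op₂ (Fin n)) →
                 Dec (∀ x y → f (x ∙ y) ≡ (f x ∘ f y))
    preserves? _∙_ _∘_ = all? λ x → all? λ y → f (x ∙ y) ≟ (f x ∘ f y)

  module _ {c ℓ : Level} {bot : Fin m} {bot′ : Fin n} (L : S.Laws bot) (L′ : T.Laws bot′) where

    lift-embedding : ∀ {f} → IsEmbedding f →
                     Embedding (S.Lifted.chain c ℓ L) (T.Lifted.chain c ℓ L′)
    lift-embedding {f} e = record
      { homomorphism = record
        { ⟦_⟧ = λ x → lift (f (lower x))
        ; isLatticeHomomorphism = record
          { isRelHomomorphism = isRelHomomorphism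
          ; ∧-homo = λ _ _ → lift (⊓-homo _ _)
          ; ∨-homo = λ _ _ → lift (⊔-homo _ _)
          }
        ; isMonoidHomomorphism = record
          { isMagmaHomomorphism = record
            { isRelHomomorphism = isRelHomomorphism
            ; homo              = λ _ _ → lift (·-homo _ _)
            }
          ; ε-homo = lift unit-homo
          }
        ; \\-homo = λ _ _ → lift (╲-homo _ _)
        ; //-homo = λ _ _ → lift (╱-homo _ _)
        }
      ; injective = λ (lift p) → lift (injective _ _ p)
      }
      where
      open IsEmbedding e
      isRelHomomorphism = record { cong = λ (lift p) → lift (cong f p) }

-- The three chains and the inclusion of the base.

-- 0F, 1F, 2F are ⊥, 1, ⊤.
A₀ : Tables 3
A₀ = record
  { mul  = (0F ∷ 0F ∷ 0F ∷ []) ∷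
           (0F ∷ 1F ∷ 2F ∷ []) ∷
           (0F ∷ 2F ∷ 2F ∷ []) ∷ []
  ; ldiv = (2F ∷ 2F ∷ 2F ∷ []) ∷
           (0F ∷ 1F ∷ 2F ∷ []) ∷
           (0F ∷ 0F ∷ 2F ∷ []) ∷ []
  ; rdiv = (2F ∷ 0F ∷ 0F ∷ []) ∷
           (2F ∷ 1F ∷ 0F ∷ []) ∷
           (2F ∷ 2F ∷ 2F ∷ []) ∷ []
  ; unit = 1F
  }

-- 0F, …, 4F are ⊥, b, 1, d, ⊤.
B₀ : Tables 5
B₀ = record
  { mul  = (0F ∷ 0F ∷ 0F ∷ 0F ∷ 0F ∷ []) ∷
           (0F ∷ 1F ∷ 1F ∷ 1F ∷ 4F ∷ []) ∷
           (0F ∷ 1F ∷ 2F ∷ 3F ∷ 4F ∷ []) ∷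
           (0F ∷ 3F ∷ 3F ∷ 3F ∷ 4F ∷ []) ∷
           (0F ∷ 4F ∷ 4F ∷ 4F ∷ 4F ∷ []) ∷ []
  ; ldiv = (4F ∷ 4F ∷ 4F ∷ 4F ∷ 4F ∷ []) ∷
           (0F ∷ 3F ∷ 3F ∷ 3F ∷ 4F ∷ []) ∷
           (0F ∷ 1F ∷ 2F ∷ 3F ∷ 4F ∷ []) ∷
           (0F ∷ 0F ∷ 0F ∷ 3F ∷ 4F ∷ []) ∷
           (0F ∷ 0F ∷ 0F ∷ 0F ∷ 4F ∷ []) ∷ []
  ; rdiv = (4F ∷ 0F ∷ 0F ∷ 0F ∷ 0F ∷ []) ∷
           (4F ∷ 2F ∷ 1F ∷ 1F ∷ 0F ∷ []) ∷
           (4F ∷ 2F ∷ 2F ∷ 1F ∷ 0F ∷ []) ∷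
           (4F ∷ 3F ∷ 3F ∷ 3F ∷ 0F ∷ []) ∷
           (4F ∷ 4F ∷ 4F ∷ 4F ∷ 4F ∷ []) ∷ []
  ; unit = 2F
  }

-- One map serves for `B₀` and for its opposite: the product of `A₀` is commutative, so `A₀` is its
-- own opposite.
inclusion : Fin 3 → Fin 5
inclusion 0F = 0F
inclusion 1F = 2F
inclusion 2F = 4F

lawsA : TableChain.Laws A₀ 0F
lawsA = from-yes (TableChain.laws? A₀ 0F)

lawsB : TableChain.Laws B₀ 0F
lawsB = from-yes (TableChain.laws? B₀ 0F)

lawsC : TableChain.Laws (opposite B₀) 0F
lawsC = from-yes (TableChain.laws? (opposite B₀) 0F)

-- Failure of amalgamation.

module _ (c ℓ : Level) where
  private
    module A = TableChain.Lifted A₀ c ℓ lawsA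
    module B = TableChain.Lifted B₀ c ℓ lawsB
    module C = TableChain.Lifted (opposite B₀) c ℓ lawsC

  A↪B : Embedding A.chain B.chain
  A↪B = TableEmbedding.lift-embedding A₀ B₀ lawsA lawsB {f = inclusion}
          (from-yes (TableEmbedding.isEmbedding? A₀ B₀ inclusion))

  A↪C : Embedding A.chain C.chain
  A↪C = TableEmbedding.lift-embedding A₀ (opposite B₀) lawsA lawsC {f = inclusion}
          (from-yes (TableEmbedding.isEmbedding? A₀ (opposite B₀) inclusion))

  -- Both classes reduce to this, since a total order makes the algebra conic.
  no-conic-idempotent-amalgam :
    (D : ResiduatedLattice c ℓ) → IsIdempotent D → IsConic D →
    (gB : Homomorphism B.chain D) (gC : Embedding C.chain D) →
    ¬ Commutes (Embedding.homomorphism A↪B) (Embedding.homomorphism A↪C)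
               gB (Embedding.homomorphism gC)
  no-conic-idempotent-amalgam D idem conic gB gC commutes =
    -- The indices `1F`, `2F`, `3F` are b, 1, d in the first chain and b′, 1, d′ in its opposite;
    -- each hypothesis is an evaluated entry carried along `gB` or `gC`.
    [ y≉ε , y′≉ε ]
      (opposite-twins-collapse D idem conic
        (≤-respʳ-≈ gB.ε-homo (trans (gB.⟦⟧-cong (lift refl)) (gB.∧-homo (lift 1F) (lift 2F))))
        (≤-respʳ-≈ gC.ε-homo (trans (gC.⟦⟧-cong (lift refl)) (gC.∧-homo (lift 1F) (lift 2F))))
        (≤-respˡ-≈ gB.ε-homo (trans (gB.⟦⟧-cong (lift refl)) (gB.∧-homo (lift 2F) (lift 3F))))
        (≤-respˡ-≈ gC.ε-homo (trans (gC.⟦⟧-cong (lift refl)) (gC.∧-homo (lift 2F) (lift 3F))))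
        (sym (gB.∙-homo (lift 1F) (lift 3F)))
        (sym (gC.∙-homo (lift 1F) (lift 3F)))
        (sym (gC.∙-homo (lift 3F) (lift 1F)))
        (trans (//-congʳ _ (sym gB.ε-homo))
          (trans (sym (gB.//-homo (lift 2F) (lift 1F))) gB.ε-homo))
        (trans (\\-congˡ _ (sym gC.ε-homo))
          (trans (sym (gC.\\-homo (lift 1F) (lift 2F))) gC.ε-homo)))
    where
    open ResiduatedLatticeProperties D
    module gB where
      open Homomorphism gB public
      open IsLatticeHomomorphism isLatticeHomomorphism public using (∧-homo; ⟦⟧-cong)
      open IsMonoidHomomorphism isMonoidHomomorphism public using (ε-homo) renaming (homo to ∙-homo)
    module gC where
      open Embedding gC public
      open IsLatticeHomomorphism isLatticeHomomorphism public using (∧-homo; ⟦⟧-cong)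
      open IsMonoidHomomorphism isMonoidHomomorphism public using (ε-homo) renaming (homo to ∙-homo)

    -- In the first chain ⊥ is the left residual of 1 by d, so it is sent above `ε` once d is sent
    -- to `ε`. As `gB` may fail to be injective, `commutes` moves the inequality to `gC`.
    ε≤bot : gB.⟦ lift 3F ⟧ ≈ ε → ε ≤ gC.⟦ lift 0F ⟧
    ε≤bot y≈ε = ≤-respʳ-≈
      (trans (\\-congˡ _ (sym gB.ε-homo))
        (trans (sym (gB.\\-homo (lift 3F) (lift 2F))) (commutes (lift 0F))))
      (Equivalence.from (\\-residual _ ε ε)
        (≤-reflexive (trans (identityʳ _) y≈ε)))

    y≉ε : ¬ gB.⟦ lift 3F ⟧ ≈ ε
    -- An embedding reflects the order, so 1 would lie below ⊥ in the opposite chain.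
    y≉ε y≈ε with () ← lower (gC.injective (trans
      (≤-respˡ-≈ (sym gC.ε-homo) (ε≤bot y≈ε)) (sym (gC.∧-homo (lift 2F) (lift 0F)))))

    y′≉ε : ¬ gC.⟦ lift 3F ⟧ ≈ ε
    y′≉ε y′≈ε with () ← lower (gC.injective (trans y′≈ε (sym gC.ε-homo)))

amalgamation⇒one-sided : ∀ {c ℓ k} {K : ResiduatedLattice c ℓ → Set k} →
                         Amalgamation K → OneSidedAmalgamation K
amalgamation⇒one-sided amalgamate A B C KA KB KC fB fC =
  let D , KD , gB , gC , commutes = amalgamate A B C KA KB KC fB fC
  in  D , KD , Embedding.homomorphism gB , gC , commutes

theorem5p2 : (c ℓ : Level) →
    ¬ OneSidedAmalgamation (IdempotentChain c ℓ) ×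
    ¬ Amalgamation (IdempotentChain c ℓ) ×
    ¬ OneSidedAmalgamation (FSIConicIdempotent c ℓ)
theorem5p2 c ℓ = chains , chains ∘ amalgamation⇒one-sided , fsi
  where
  module A = TableChain.Lifted A₀ c ℓ lawsA
  module B = TableChain.Lifted B₀ c ℓ lawsB
  module C = TableChain.Lifted (opposite B₀) c ℓ lawsC

  chains : ¬ OneSidedAmalgamation (IdempotentChain c ℓ)
  chains amalgamate =
    let D , (idem , total) , gB , gC , commutes =
          amalgamate A.chain B.chain C.chain
            A.idempotentChain B.idempotentChain C.idempotentChain
            (A↪B c ℓ) (A↪C c ℓ)
    in  no-conic-idempotent-amalgam c ℓ D idem (λ a → total a _) gB gC commutes

  fsi : ¬ OneSidedAmalgamation (FSIConicIdempotent c ℓ)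
  fsi amalgamate =
    let D , (_ , conic , idem) , gB , gC , commutes =
          amalgamate A.chain B.chain C.chain
            A.fsiConicIdempotent B.fsiConicIdempotent C.fsiConicIdempotent
            (A↪B c ℓ) (A↪C c ℓ)
    in  no-conic-idempotent-amalgam c ℓ D idem conic gB gC commutes
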